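{- Let a product two-action game with $m$ players be given, and let $\pi\in\mathrm{Der}_m$. Then the set $EC(\pi)$ consists of exactly one point, namely $\underline\gamma$ with $\gamma^j=a^{\pi(j)}_j$ for all $j\in\mathcal A$, and this point is a Nash equilibrium (with all $\gamma^j\in(0,1)$). In particular the game has at least $!m$ Nash equilibria in the open cube $(0,1)^m$.
   Context: Fix an integer $m\ge 1$ and $\mathcal A=\{1,\dots,m\}$. A two-action game is a finite game in normal form with player set $\mathcal A$ in which each player $i$ has exactly two pure strategies $s^i_0,s^i_1$, together with utility functions $U^i:S\to\mathbb R$, where $S=\prod_{i\in\mathcal A}\{s^i_0,s^i_1\}$. A mixed strategy combination is identified with $\underline\gamma=(\gamma^1,\dots,\gamma^m)\in[0,1]^m$, where $\gamma^i$ is the probability with which player $i$ plays $s^i_1$. The expected utility $V^i$ is the multilinear extension $V^i(\underline\gamma)=\sum_{(j_1,\dots,j_m)\in\{0,1\}^m}\prod_{k=1}^m p_k(j_k)\,U^i(s^1_{j_1},\dots,s^m_{j_m})$ with $p_k(1)=\gamma^k$, $p_k(0)=1-\gamma^k$. Write $\underline\gamma^{ -i}=(\gamma^j)_{j\ne i}$ and $\lambda^i(\underline\gamma^{ -i}):=V^i(\underline\gamma)|_{\gamma^i=1}-V^i(\underline\gamma)|_{\gamma^i=0}$. A Nash equilibrium is a point $\underline\gamma\in[0,1]^m$ such that for every $i$: $\lambda^i(\underline\gamma^{ -i})=0$ if $0<\gamma^i<1$; $\lambda^i(\underline\gamma^{ -i})\le 0$ if $\gamma^i=0$; $\lambda^i(\underline\gamma^{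 -i})\ge 0$ if $\gamma^i=1$. For $\underline\gamma$ put $L_0(\underline\gamma)=\{i:\gamma^i=0\}$, $L_1(\underline\gamma)=\{i:\gamma^i=1\}$, $L(\underline\gamma)=L_0(\underline\gamma)\cup L_1(\underline\gamma)$. A two-action game is a product two-action game if there exist $\underline v=(v_1,\dots,v_m)\in\{0,1\}^m$ and numbers $a^i_j\in(0,1)$ for $i,j\in\mathcal A$, $i\ne j$, with $a^{i_1}_j\neq a^{i_2}_j$ whenever $i_1\neq i_2$ and both differ from $j$, such that $\lambda^i(\underline\gamma^{ -i})=(-1)^{v_i}\prod_{j\in\mathcal A\setminus\{i\}}(\gamma^j-a^i_j)$ for every $i\in\mathcal A$. For $\pi\in S_m$, $F(\pi)=\{i\in\mathcal A:\pi(i)=i\}$; $\mathrm{Der}_m$ is the set of $\pi\in S_m$ with $F(\pi)=\emptyset$; $!m=|\mathrm{Der}_m|$. $EC(\pi):=\{\underline\gamma\in[0,1]^m \mid L(\underline\gamma)=F(\pi),\ \gamma^j=a^{\pi(j)}_j \text{ for all } j\notin F(\pi)\}$. -}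

module Defs where

open import Data.Fin.Base using (Fin; zero; suc; punchIn)
open import Data.Fin.Patterns using (0F; 1F)
open import Data.Fin.Permutation using (Permutation′; _⟨$⟩ʳ_; insert; remove; insert-punchIn; insert-remove) renaming (id to idₚ; _≈_ to _≈ₚ_)
open import Data.Fin.Properties using (_≟_; all?; punchIn-injective)
open import Data.List.Base using (List; []; _∷_; [_]; map; foldr; filter; allFin; cartesianProductWith; length)
open import Data.List.Membership.Propositional.Properties using (∈-allFin)
open import Data.List.Membership.Setoid.Properties using (∈-cartesianProductWith⁺; ∈-resp-≈)
open import Data.List.Relation.Unary.All using ([])
open import Data.List.Relation.Unary.AllPairs using (AllPairs; []; _∷_)
open import Data.List.Relation.Unary.Any using (Any; here)
open import Data.List.Relation.Unary.Unique.Propositional.Properties using (allFin⁺)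
open import Data.List.Relation.Unary.Unique.Setoid.Properties using (cartesianProductWith⁺)
open import Data.Nat.Base as ℕ using (ℕ; zero; suc)
import Data.Nat.Properties as ℕ
open import Data.Product.Base using (∃; _×_; _,_)
open import Data.Rational.Base as ℚ using (ℚ; 0ℚ; 1ℚ; ½)
import Data.Rational.Properties as ℚ
open import Data.Rational.Solver using (module +-*-Solver)
open import Data.Vec.Base using (Vec; []; _∷_; lookup)
open import Data.Vec.Functional using (Vector; updateAt)
open import Function.Base using (const)
open import Level using (0ℓ)
open import Relation.Binary.Bundles using (Setoid)
open import Relation.Binary.PropositionalEquality as ≡ using (_≡_; _≢_; refl; sym; trans; cong; subst)
open import Relation.Nullary using (¬_; ¬?; Dec)
open import Relation.Unary using (Pred; _∈_; _∪_; _≐_; Empty)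

-- Real numbers: Cauchy sequences of rationals carrying a modulus of
-- convergence, considered up to _≈_.

infix 4 _≈_ _≉_ _<_ _≤_
infix  8 -_
infixl 6 _+_ _-_
infixl 7 _*_

Eventually : Pred ℕ 0ℓ → Set
Eventually P = ∃ λ N → ∀ n → N ℕ.≤ n → P n

Cauchy : (ℕ → ℚ) → Set
Cauchy x = ∀ ε → 0ℚ ℚ.< ε →
  ∃ λ N → ∀ m n → N ℕ.≤ m → N ℕ.≤ n → ℚ.∣ x m ℚ.- x n ∣ ℚ.< ε

record ℝ : Set where
  constructor mkℝ
  field
    seq    : ℕ → ℚ
    cauchy : Cauchy seq

open ℝ public

_≈_ : ℝ → ℝ → Set
x ≈ y = ∀ ε → 0ℚ ℚ.< ε → Eventually λ n → ℚ.∣ seq x n ℚ.- seq y n ∣ ℚ.< ε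

_≉_ : ℝ → ℝ → Set
x ≉ y = ¬ (x ≈ y)

_<_ : ℝ → ℝ → Set
x < y = ∃ λ ε → 0ℚ ℚ.< ε × Eventually λ n → seq x n ℚ.+ ε ℚ.< seq y n

_≤_ : ℝ → ℝ → Set
x ≤ y = ∀ ε → 0ℚ ℚ.< ε → Eventually λ n → seq x n ℚ.< seq y n ℚ.+ ε

fromℚ : ℚ → ℝ
fromℚ q = mkℝ (const q) λ ε 0<ε → 0 , λ _ _ _ _ →
  subst (ℚ._< ε) (sym (cong ℚ.∣_∣ (ℚ.+-inverseʳ q))) 0<ε

0ℝ 1ℝ : ℝ
0ℝ = fromℚ 0ℚ
1ℝ = fromℚ 1ℚ

private
  0<½* : ∀ {ε} → 0ℚ ℚ.< ε → 0ℚ ℚ.< ½ ℚ.* ε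
  0<½* {ε} 0<ε = ℚ.positive⁻¹ (½ ℚ.* ε) {{ℚ.pos*pos⇒pos ½ ε {{ℚ.positive 0<ε}}}}

  ½+½ : ∀ ε → ½ ℚ.* ε ℚ.+ ½ ℚ.* ε ≡ ε
  ½+½ ε = trans (sym (ℚ.*-distribʳ-+ ε ½ ½)) (ℚ.*-identityˡ ε)

  m≤ : ∀ {M N n} → M ℕ.⊔ N ℕ.≤ n → M ℕ.≤ n
  m≤ {M} {N} = ℕ.≤-trans (ℕ.m≤m⊔n M N)

  n≤ : ∀ {M N n} → M ℕ.⊔ N ℕ.≤ n → N ℕ.≤ n
  n≤ {M} {N} = ℕ.≤-trans (ℕ.m≤n⊔m M N)

  open +-*-Solver using (solve; _:+_; _:*_; _:-_; :-_; _:=_)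

  +-regroup : ∀ a b c d → (a ℚ.+ b) ℚ.- (c ℚ.+ d) ≡ (a ℚ.- c) ℚ.+ (b ℚ.- d)
  +-regroup = solve 4 (λ a b c d → (a :+ b) :- (c :+ d) := (a :- c) :+ (b :- d)) refl

  neg-regroup : ∀ a b → (ℚ.- a) ℚ.- (ℚ.- b) ≡ ℚ.- (a ℚ.- b)
  neg-regroup = solve 2 (λ a b → (:- a) :- (:- b) := :- (a :- b)) refl

  *-regroup : ∀ a b c d → a ℚ.* b ℚ.- c ℚ.* d ≡ a ℚ.* (b ℚ.- d) ℚ.+ d ℚ.* (a ℚ.- c)
  *-regroup = solve 4 (λ a b c d → a :* b :- c :* d := a :* (b :- d) :+ d :* (a :- c)) refl

  split : ∀ a b → a ≡ (a ℚ.- b) ℚ.+ b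
  split = solve 2 (λ a b → a := (a :- b) :+ b) refl

abstract
  +-cauchy : ∀ x y → Cauchy (λ n → seq x n ℚ.+ seq y n)
  +-cauchy x y ε 0<ε
    with M , p ← cauchy x (½ ℚ.* ε) (0<½* 0<ε)
       | N , q ← cauchy y (½ ℚ.* ε) (0<½* 0<ε)
    = M ℕ.⊔ N , λ m n h k → begin-strict
      ℚ.∣ (seq x m ℚ.+ seq y m) ℚ.- (seq x n ℚ.+ seq y n) ∣
        ≡⟨ cong ℚ.∣_∣ (+-regroup (seq x m) (seq y m) (seq x n) (seq y n)) ⟩
      ℚ.∣ (seq x m ℚ.- seq x n) ℚ.+ (seq y m ℚ.- seq y n) ∣
        ≤⟨ ℚ.∣p+q∣≤∣p∣+∣q∣ (seq x m ℚ.- seq x n) (seq y m ℚ.- seq y n) ⟩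
      ℚ.∣ seq x m ℚ.- seq x n ∣ ℚ.+ ℚ.∣ seq y m ℚ.- seq y n ∣
        <⟨ ℚ.+-mono-< (p m n (m≤ h) (m≤ k)) (q m n (n≤ {M} h) (n≤ {M} k)) ⟩
      ½ ℚ.* ε ℚ.+ ½ ℚ.* ε ≡⟨ ½+½ ε ⟩
      ε ∎
    where open ℚ.≤-Reasoning

  neg-cauchy : ∀ x → Cauchy (λ n → ℚ.- seq x n)
  neg-cauchy x ε 0<ε with N , p ← cauchy x ε 0<ε = N , λ m n h k →
    subst (ℚ._< ε)
      (sym (trans (cong ℚ.∣_∣ (neg-regroup (seq x m) (seq x n))) (ℚ.∣-p∣≡∣p∣ (seq x m ℚ.- seq x n))))
      (p m n h k)

bounded : ∀ x → ∃ λ B → 0ℚ ℚ.< B × Eventually λ n → ℚ.∣ seq x n ∣ ℚ.< B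
bounded x with N , p ← cauchy x 1ℚ (ℚ.positive⁻¹ 1ℚ)
  = 1ℚ ℚ.+ ℚ.∣ seq x N ∣
  , ℚ.+-mono-<-≤ (ℚ.positive⁻¹ 1ℚ) (ℚ.0≤∣p∣ (seq x N))
  , N , λ n h → begin-strict
    ℚ.∣ seq x n ∣ ≡⟨ cong ℚ.∣_∣ (split (seq x n) (seq x N)) ⟩
    ℚ.∣ (seq x n ℚ.- seq x N) ℚ.+ seq x N ∣
      ≤⟨ ℚ.∣p+q∣≤∣p∣+∣q∣ (seq x n ℚ.- seq x N) (seq x N) ⟩
    ℚ.∣ seq x n ℚ.- seq x N ∣ ℚ.+ ℚ.∣ seq x N ∣
      <⟨ ℚ.+-monoˡ-< ℚ.∣ seq x N ∣ (p n N h ℕ.≤-refl) ⟩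
    1ℚ ℚ.+ ℚ.∣ seq x N ∣ ∎
  where open ℚ.≤-Reasoning

private
  divide : ∀ {B ε} → 0ℚ ℚ.< B → 0ℚ ℚ.< ε → ∃ λ δ → 0ℚ ℚ.< δ × B ℚ.* δ ≡ ε
  divide {B} {ε} 0<B 0<ε = 1/B ℚ.* ε
    , ℚ.positive⁻¹ (1/B ℚ.* ε) {{ℚ.pos*pos⇒pos 1/B {{ℚ.1/pos⇒pos B}} ε {{ℚ.positive 0<ε}}}}
    , trans (sym (ℚ.*-assoc B 1/B ε)) (trans (cong (ℚ._* ε) (ℚ.*-inverseʳ B)) (ℚ.*-identityˡ ε))
    where
    instance
      B-pos : ℚ.Positive B
      B-pos = ℚ.positive 0<B
      B-nz : ℚ.NonZero B
      B-nz = ℚ.pos⇒nonZero B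
    1/B = ℚ.1/ B

  *-bound : ∀ {p q B δ} → ℚ.∣ p ∣ ℚ.< B → ℚ.∣ q ∣ ℚ.< δ → 0ℚ ℚ.< δ → ℚ.∣ p ℚ.* q ∣ ℚ.< B ℚ.* δ
  *-bound {p} {q} {B} {δ} p<B q<δ 0<δ = begin-strict
    ℚ.∣ p ℚ.* q ∣       ≡⟨ ℚ.∣p*q∣≡∣p∣*∣q∣ p q ⟩
    ℚ.∣ p ∣ ℚ.* ℚ.∣ q ∣ ≤⟨ ℚ.*-monoˡ-≤-nonNeg ℚ.∣ p ∣ {{ℚ.∣-∣-nonNeg p}} (ℚ.<⇒≤ q<δ) ⟩
    ℚ.∣ p ∣ ℚ.* δ       <⟨ ℚ.*-monoˡ-<-pos δ {{ℚ.positive 0<δ}} p<B ⟩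
    B ℚ.* δ             ∎
    where open ℚ.≤-Reasoning

  *-diff : ∀ {p q r s A B δ} → ℚ.∣ p ∣ ℚ.< A → ℚ.∣ s ∣ ℚ.< B → 0ℚ ℚ.< δ →
    ℚ.∣ p ℚ.- r ∣ ℚ.< δ → ℚ.∣ q ℚ.- s ∣ ℚ.< δ →
    ℚ.∣ p ℚ.* q ℚ.- r ℚ.* s ∣ ℚ.< (A ℚ.+ B) ℚ.* δ
  *-diff {p} {q} {r} {s} {A} {B} {δ} p<A s<B 0<δ p-r<δ q-s<δ = begin-strict
    ℚ.∣ p ℚ.* q ℚ.- r ℚ.* s ∣
      ≡⟨ cong ℚ.∣_∣ (*-regroup p q r s) ⟩
    ℚ.∣ p ℚ.* (q ℚ.- s) ℚ.+ s ℚ.* (p ℚ.- r) ∣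
      ≤⟨ ℚ.∣p+q∣≤∣p∣+∣q∣ (p ℚ.* (q ℚ.- s)) (s ℚ.* (p ℚ.- r)) ⟩
    ℚ.∣ p ℚ.* (q ℚ.- s) ∣ ℚ.+ ℚ.∣ s ℚ.* (p ℚ.- r) ∣
      <⟨ ℚ.+-mono-< (*-bound {p} {q ℚ.- s} p<A q-s<δ 0<δ) (*-bound {s} {p ℚ.- r} s<B p-r<δ 0<δ) ⟩
    A ℚ.* δ ℚ.+ B ℚ.* δ ≡⟨ ℚ.*-distribʳ-+ δ A B ⟨
    (A ℚ.+ B) ℚ.* δ     ∎
    where open ℚ.≤-Reasoning

abstract
  *-cauchy : ∀ x y → Cauchy (λ n → seq x n ℚ.* seq y n)
  *-cauchy x y ε 0<ε =
    let A , 0<A , K , a = bounded x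
        B , 0<B , L , b = bounded y
        δ , 0<δ , eq    = divide (ℚ.+-mono-< 0<A 0<B) 0<ε
        M , p           = cauchy x δ 0<δ
        N , q           = cauchy y δ 0<δ
        KL              = K ℕ.⊔ L
        MN              = M ℕ.⊔ N
    in KL ℕ.⊔ MN , λ m n h k →
      subst (ℚ.∣ seq x m ℚ.* seq y m ℚ.- seq x n ℚ.* seq y n ∣ ℚ.<_) eq
        (*-diff {seq x m} {seq y m} {seq x n} {seq y n}
          (a m (m≤ {K} {L} (m≤ {KL} {MN} h)))
          (b n (n≤ {K} {L} (m≤ {KL} {MN} k)))
          0<δ
          (p m n (m≤ {M} {N} (n≤ {KL} {MN} h)) (m≤ {M} {N} (n≤ {KL} {MN} k)))
          (q m n (n≤ {M} {N} (n≤ {KL} {MN} h)) (n≤ {M} {N} (n≤ {KL} {MN} k))))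

-_ : ℝ → ℝ
- x = mkℝ (λ n → ℚ.- seq x n) (neg-cauchy x)

_+_ _-_ _*_ : ℝ → ℝ → ℝ
x + y = mkℝ (λ n → seq x n ℚ.+ seq y n) (+-cauchy x y)
x - y = x + (- y)
x * y = mkℝ (λ n → seq x n ℚ.* seq y n) (*-cauchy x y)

sumℝ productℝ : List ℝ → ℝ
sumℝ     = foldr _+_ 0ℝ
productℝ = foldr _*_ 1ℝ

-- Pure strategy s^i_j is encoded by its index j.
Profile : ℕ → Set
Profile m = Vec (Fin 2) m

profiles : ∀ m → List (Profile m)
profiles zero    = [ [] ]
profiles (suc m) = cartesianProductWith _∷_ (allFin 2) (profiles m)

record TwoActionGame (m : ℕ) : Set where
  field U : Fin m → Profile m → ℝ

Point : ℕ → Set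
Point = Vector ℝ

_≋_ : ∀ {m} → Point m → Point m → Set
γ ≋ δ = ∀ j → γ j ≈ δ j

Cube OpenCube : ∀ {m} → Pred (Point m) 0ℓ
Cube     γ = ∀ j → 0ℝ ≤ γ j × γ j ≤ 1ℝ
OpenCube γ = ∀ j → 0ℝ < γ j × γ j < 1ℝ

prob : ℝ → Fin 2 → ℝ
prob x 0F = 1ℝ - x
prob x 1F = x

_[_≔_] : ∀ {m} → Point m → Fin m → ℝ → Point m
γ [ i ≔ x ] = updateAt γ i (const x)

module _ {m} (G : TwoActionGame m) where
  open TwoActionGame G

  V : Fin m → Point m → ℝ
  V i γ = sumℝ (map term (profiles m))
    where
    term : Profile m → ℝ
    term s = productℝ (map (λ k → prob (γ k) (lookup s k)) (allFin m)) * U i s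

  -- Λ i γ is λ^i(γ^{-i}); the coordinate γ i is overwritten.
  Λ : Fin m → Point m → ℝ
  Λ i γ = V i (γ [ i ≔ 1ℝ ]) - V i (γ [ i ≔ 0ℝ ])

  record IsNash (γ : Point m) : Set where
    field
      inCube   : γ ∈ Cube
      interior : ∀ i → 0ℝ < γ i → γ i < 1ℝ → Λ i γ ≈ 0ℝ
      atZero   : ∀ i → γ i ≈ 0ℝ → Λ i γ ≤ 0ℝ
      atOne    : ∀ i → γ i ≈ 1ℝ → 0ℝ ≤ Λ i γ

L₀ L₁ L : ∀ {m} → Point m → Pred (Fin m) 0ℓ
L₀ γ i = γ i ≈ 0ℝ
L₁ γ i = γ i ≈ 1ℝ
L γ    = L₀ γ ∪ L₁ γ

[-1]^_ : Fin 2 → ℝ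
[-1]^ 0F = 1ℝ
[-1]^ 1F = - 1ℝ

others : ∀ {m} → Fin m → List (Fin m)
others {m} i = filter (λ j → ¬? (j ≟ i)) (allFin m)

-- a i j is a^i_j; the diagonal values a i i are unconstrained and unused.
record IsProductGame {m} (G : TwoActionGame m) : Set where
  field
    v          : Vector (Fin 2) m
    a          : Fin m → Fin m → ℝ
    a-interior : ∀ i j → i ≢ j → 0ℝ < a i j × a i j < 1ℝ
    a-distinct : ∀ i₁ i₂ j → i₁ ≢ i₂ → i₁ ≢ j → i₂ ≢ j → a i₁ j ≉ a i₂ j
    Λ-product  : ∀ i γ → γ ∈ Cube →
      Λ G i γ ≈ ([-1]^ v i) * productℝ (map (λ j → γ j - a i j) (others i))

F : ∀ {m} → Permutation′ m → Pred (Fin m) 0ℓ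
F π i = π ⟨$⟩ʳ i ≡ i

Der : ∀ m → Pred (Permutation′ m) 0ℓ
Der m π = Empty (F π)

Der? : ∀ {m} (π : Permutation′ m) → Dec (π ∈ Der m)
Der? π = all? λ i → ¬? (π ⟨$⟩ʳ i ≟ i)

permutations : ∀ m → List (Permutation′ m)
permutations zero    = [ idₚ ]
permutations (suc m) = cartesianProductWith (insert zero) (allFin (suc m)) (permutations m)

-- permutations m lists every permutation exactly once up to _≈ₚ_
-- (permutations-complete, permutations-distinct), so that ! m = |Der_m|.
private
  Permutation-setoid : ℕ → Setoid 0ℓ 0ℓ
  Permutation-setoid m = record
    { Carrier       = Permutation′ m
    ; _≈_           = _≈ₚ_
    ; isEquivalence = record
      { refl  = λ _ → refl
      ; sym   = λ p i → sym (p i)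
      ; trans = λ p q i → trans (p i) (q i)
      }
    }

  insert-cong : ∀ {m} {j k : Fin (suc m)} {π ρ : Permutation′ m} →
    j ≡ k → π ≈ₚ ρ → insert zero j π ≈ₚ insert zero k ρ
  insert-cong refl p zero    = refl
  insert-cong {j = j} {π = π} {ρ} refl p (suc i) =
    trans (insert-punchIn zero j π i)
      (trans (cong (punchIn j) (p i)) (sym (insert-punchIn zero j ρ i)))

  insert-injective : ∀ {m} {j k : Fin (suc m)} {π ρ : Permutation′ m} →
    insert zero j π ≈ₚ insert zero k ρ → j ≡ k × π ≈ₚ ρ
  insert-injective {j = j} {π = π} {ρ} p with refl ← p zero =
    refl , λ i → punchIn-injective j _ _
      (trans (sym (insert-punchIn zero j π i)) (trans (p (suc i)) (insert-punchIn zero j ρ i)))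

permutations-complete : ∀ m (π : Permutation′ m) → Any (π ≈ₚ_) (permutations m)
permutations-complete zero    π = here λ ()
permutations-complete (suc m) π =
  ∈-resp-≈ (Permutation-setoid (suc m)) {permutations (suc m)}
    {insert zero (π ⟨$⟩ʳ zero) (remove zero π)} {π} (insert-remove zero π)
    (∈-cartesianProductWith⁺ (≡.setoid (Fin (suc m))) (Permutation-setoid m)
      (Permutation-setoid (suc m))
      (λ {j} {k} {π} {ρ} → insert-cong {j = j} {k} {π} {ρ})
      (∈-allFin (π ⟨$⟩ʳ zero)) (permutations-complete m (remove zero π)))

permutations-distinct : ∀ m → AllPairs (λ π ρ → ¬ (π ≈ₚ ρ)) (permutations m)
permutations-distinct zero    = [] ∷ []
permutations-distinct (suc m) =
  cartesianProductWith⁺ (≡.setoid (Fin (suc m))) (Permutation-setoid m)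
    (Permutation-setoid (suc m)) (insert zero)
    (λ {j} {k} {π} {ρ} → insert-injective {j = j} {k} {π} {ρ})
    (allFin⁺ (suc m)) (permutations-distinct m)

!_ : ℕ → ℕ
! m = length (filter Der? (permutations m))

EC : ∀ {m} {G : TwoActionGame m} → IsProductGame G → Permutation′ m → Pred (Point m) 0ℓ
EC P π γ = γ ∈ Cube
         × L γ ≐ F π
         × (∀ j → ¬ (j ∈ F π) → γ j ≈ a (π ⟨$⟩ʳ j) j)
  where open IsProductGame P

{-# OPTIONS --safe #-}
module Submission where

open import Defs
open import Data.Fin.Base using (Fin; zero; suc)
open import Data.Fin.Permutation using (Permutation′; _⟨$⟩ʳ_; _⟨$⟩ˡ_; inverseʳ) renaming (_≈_ to _≈ₚ_)
open import Data.Fin.Properties using (_≟_)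
open import Data.List.Base using (List; _∷_; filter; lookup; map)
open import Data.List.Membership.Propositional using () renaming (_∈_ to _∈ₗ_)
open import Data.List.Membership.Propositional.Properties using (∈-allFin; ∈-filter⁺; ∈-lookup; ∈-map⁺)
import Data.List.Relation.Unary.All as All
open import Data.List.Relation.Unary.All.Properties using (all-filter)
open import Data.List.Relation.Unary.AllPairs using (AllPairs; _∷_)
open import Data.List.Relation.Unary.AllPairs.Properties using (filter⁺)
open import Data.List.Relation.Unary.Any using (here; there)
open import Data.Nat.Base as ℕ using (ℕ; NonZero)
import Data.Nat.Properties as ℕ
open import Data.Product.Base using (_×_; _,_; proj₁; proj₂; Σ-syntax)
open import Data.Rational.Base as ℚ using (ℚ; 0ℚ; ½)
import Data.Rational.Properties as ℚ
open import Data.Rational.Solver using (module +-*-Solver)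
open import Data.Sum.Base using (inj₁; inj₂; [_,_]′)
open import Function.Base using (_∘_)
open import Relation.Binary.Core using (Rel)
open import Relation.Binary.Definitions using (Symmetric)
open import Relation.Binary.PropositionalEquality using (_≡_; refl; sym; trans; cong; subst)
open import Relation.Nullary using (¬_; ¬?; contradiction)
open import Relation.Nullary.Decidable using (decidable-stable)
open import Relation.Unary using (_∈_)

open +-*-Solver using (solve; _:+_; _:-_; :-_; _:=_)

-- Each `Λ G i` is, up to sign, a product of factors `γ j - a i j` over `j` different from `i`. For
-- a derangement `π`, the index `j = π⁻¹(i)` differs from `i`, so its factor occurs in the product,
-- and it vanishes when `γ j` is `a (π j) j`. Hence every `Λ G i` is zero at `point π`
-- (`Λ-point≈0`). The point has no coordinate 0 or 1, so the vanishing already makes it an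
-- equilibrium (`interiorNash`).
--
-- Since `F π` is empty, the last clause of `EC` fixes every coordinate, which gives uniqueness. For
-- the count, two derangements that differ at `j` give different `j`-th coordinates by `a-distinct`
-- (`point-injective`), and the derangements are listed without repetition. The real-number lemmas
-- supply two facts: a strict inequality excludes equality, and a product with a zero factor is
-- zero.

∣p-q∣≡∣q-p∣ : ∀ p q → ℚ.∣ p ℚ.- q ∣ ≡ ℚ.∣ q ℚ.- p ∣
∣p-q∣≡∣q-p∣ p q = trans
  (cong ℚ.∣_∣ (solve 2 (λ p q → p :- q := :- (q :- p)) refl p q))
  (ℚ.∣-p∣≡∣p∣ (q ℚ.- p))

∣p-r∣≤∣p-q∣+∣q-r∣ : ∀ p q r → ℚ.∣ p ℚ.- r ∣ ℚ.≤ ℚ.∣ p ℚ.- q ∣ ℚ.+ ℚ.∣ q ℚ.- r ∣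
∣p-r∣≤∣p-q∣+∣q-r∣ p q r = subst (ℚ._≤ ℚ.∣ p ℚ.- q ∣ ℚ.+ ℚ.∣ q ℚ.- r ∣)
  (cong ℚ.∣_∣ (solve 3 (λ p q r → (p :- q) :+ (q :- r) := p :- r) refl p q r))
  (ℚ.∣p+q∣≤∣p∣+∣q∣ (p ℚ.- q) (q ℚ.- r))

p+ε<q⇒ε<∣q-p∣ : ∀ {p q ε} → 0ℚ ℚ.< ε → p ℚ.+ ε ℚ.< q → ε ℚ.< ℚ.∣ q ℚ.- p ∣
p+ε<q⇒ε<∣q-p∣ {p} {q} {ε} 0<ε p+ε<q =
  subst (ε ℚ.<_) (sym (ℚ.0≤p⇒∣p∣≡p (ℚ.<⇒≤ (ℚ.<-trans 0<ε ε<q-p)))) ε<q-p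
  where
  ε<q-p : ε ℚ.< q ℚ.- p
  ε<q-p = subst (ℚ._< q ℚ.- p)
    (solve 2 (λ p ε → (p :+ ε) :- p := ε) refl p ε)
    (ℚ.+-monoˡ-< (ℚ.- p) p+ε<q)

-- Operations on reals act index by index, so this carries rational identities such as commutativity
-- and cancellation over to reals.
≈-pointwise : ∀ {x y} → (∀ n → seq x n ≡ seq y n) → x ≈ y
≈-pointwise {x} {y} x≗y ε 0<ε = 0 , λ n _ → subst (ℚ._< ε)
  (cong ℚ.∣_∣ (sym (trans (cong (ℚ._- seq y n) (x≗y n)) (ℚ.+-inverseʳ (seq y n))))) 0<ε

≈-refl : ∀ {x} → x ≈ x
≈-refl {x} = ≈-pointwise {x} {x} λ _ → refl

≈-sym : ∀ {x y} → x ≈ y → y ≈ x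
≈-sym {x} {y} x≈y ε 0<ε with N , p ← x≈y ε 0<ε = N , λ n h →
  subst (ℚ._< ε) (∣p-q∣≡∣q-p∣ (seq x n) (seq y n)) (p n h)

0<½*ε : ∀ {ε} → 0ℚ ℚ.< ε → 0ℚ ℚ.< ½ ℚ.* ε
0<½*ε {ε} 0<ε = ℚ.positive⁻¹ (½ ℚ.* ε) {{ℚ.pos*pos⇒pos ½ ε {{ℚ.positive 0<ε}}}}

≈-trans : ∀ {x y z} → x ≈ y → y ≈ z → x ≈ z
≈-trans {x} {y} {z} x≈y y≈z ε 0<ε
  with M , p ← x≈y (½ ℚ.* ε) (0<½*ε 0<ε) | N , q ← y≈z (½ ℚ.* ε) (0<½*ε 0<ε)
  = M ℕ.⊔ N , λ n h → begin-strict
  ℚ.∣ seq x n ℚ.- seq z n ∣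
    ≤⟨ ∣p-r∣≤∣p-q∣+∣q-r∣ (seq x n) (seq y n) (seq z n) ⟩
  ℚ.∣ seq x n ℚ.- seq y n ∣ ℚ.+ ℚ.∣ seq y n ℚ.- seq z n ∣
    <⟨ ℚ.+-mono-< (p n (ℕ.m⊔n≤o⇒m≤o M N h)) (q n (ℕ.m⊔n≤o⇒n≤o M N h)) ⟩
  ½ ℚ.* ε ℚ.+ ½ ℚ.* ε
    ≡⟨ ℚ.*-distribʳ-+ ε ½ ½ ⟨
  (½ ℚ.+ ½) ℚ.* ε
    ≡⟨ ℚ.*-identityˡ ε ⟩
  ε ∎
  where open ℚ.≤-Reasoning

<⇒≤ : ∀ {x y} → x < y → x ≤ y
<⇒≤ {x} {y} (ε , 0<ε , N , p) δ 0<δ = N , λ n h → begin-strict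
  seq x n          ≡⟨ ℚ.+-identityʳ (seq x n) ⟨
  seq x n ℚ.+ 0ℚ   <⟨ ℚ.+-monoʳ-< (seq x n) 0<ε ⟩
  seq x n ℚ.+ ε    <⟨ p n h ⟩
  seq y n          ≡⟨ ℚ.+-identityʳ (seq y n) ⟨
  seq y n ℚ.+ 0ℚ   <⟨ ℚ.+-monoʳ-< (seq y n) 0<δ ⟩
  seq y n ℚ.+ δ    ∎
  where open ℚ.≤-Reasoning

-- The gap witnessing the strict inequality serves as the tolerance in `x ≈ y`; the two bounds clash
-- at any index past both thresholds.
>⇒≉ : ∀ {x y} → y < x → x ≉ y
>⇒≉ {x} {y} (ε , 0<ε , M , p) x≈y with N , q ← x≈y ε 0<ε =
  ℚ.<-asym (q (M ℕ.⊔ N) (ℕ.m≤n⊔m M N))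
    (p+ε<q⇒ε<∣q-p∣ {seq y (M ℕ.⊔ N)} {seq x (M ℕ.⊔ N)} 0<ε (p (M ℕ.⊔ N) (ℕ.m≤m⊔n M N)))

<⇒≉ : ∀ {x y} → x < y → x ≉ y
<⇒≉ {x} {y} x<y x≈y = >⇒≉ {y} {x} x<y (≈-sym {x} {y} x≈y)

divide : ∀ {B ε} → 0ℚ ℚ.< B → 0ℚ ℚ.< ε → Σ[ δ ∈ ℚ ] 0ℚ ℚ.< δ × B ℚ.* δ ≡ ε
divide {B} {ε} 0<B 0<ε = δ , ℚ.positive⁻¹ δ {{δ-pos}} , B*δ≡ε
  where
  instance
    B-pos : ℚ.Positive B
    B-pos = ℚ.positive 0<B

    B-nonZero : ℚ.NonZero B
    B-nonZero = ℚ.pos⇒nonZero B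

  δ : ℚ
  δ = ℚ.1/ B ℚ.* ε

  δ-pos : ℚ.Positive δ
  δ-pos = ℚ.pos*pos⇒pos (ℚ.1/ B) {{ℚ.1/pos⇒pos B}} ε {{ℚ.positive 0<ε}}

  B*δ≡ε : B ℚ.* δ ≡ ε
  B*δ≡ε = trans (sym (ℚ.*-assoc B (ℚ.1/ B) ε))
    (trans (cong (ℚ._* ε) (ℚ.*-inverseʳ B)) (ℚ.*-identityˡ ε))

∣p*q∣<B*δ : ∀ {p q B δ} → 0ℚ ℚ.< δ → ℚ.∣ p ∣ ℚ.< B → ℚ.∣ q ∣ ℚ.< δ → ℚ.∣ p ℚ.* q ∣ ℚ.< B ℚ.* δ
∣p*q∣<B*δ {p} {q} {B} {δ} 0<δ ∣p∣<B ∣q∣<δ = begin-strict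
  ℚ.∣ p ℚ.* q ∣       ≡⟨ ℚ.∣p*q∣≡∣p∣*∣q∣ p q ⟩
  ℚ.∣ p ∣ ℚ.* ℚ.∣ q ∣ ≤⟨ ℚ.*-monoˡ-≤-nonNeg ℚ.∣ p ∣ {{ℚ.∣-∣-nonNeg p}} (ℚ.<⇒≤ ∣q∣<δ) ⟩
  ℚ.∣ p ∣ ℚ.* δ       <⟨ ℚ.*-monoˡ-<-pos δ {{ℚ.positive 0<δ}} ∣p∣<B ⟩
  B ℚ.* δ             ∎
  where open ℚ.≤-Reasoning

-- A Cauchy sequence is bounded, say by `B`, so it suffices that `x` eventually stays within `ε / B`
-- of zero.
x≈0⇒y*x≈0 : ∀ y {x} → x ≈ 0ℝ → y * x ≈ 0ℝ
x≈0⇒y*x≈0 y {x} x≈0 ε 0<ε =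
  let B , 0<B , M , p  = bounded y
      δ , 0<δ , B*δ≡ε  = divide {B} {ε} 0<B 0<ε
      N , q            = x≈0 δ 0<δ
  in M ℕ.⊔ N , λ n h →
    subst (λ r → ℚ.∣ r ∣ ℚ.< ε) (sym (ℚ.+-identityʳ (seq y n ℚ.* seq x n)))
      (subst (ℚ.∣ seq y n ℚ.* seq x n ∣ ℚ.<_) B*δ≡ε
        (∣p*q∣<B*δ {seq y n} {seq x n} {B} {δ} 0<δ (p n (ℕ.m⊔n≤o⇒m≤o M N h))
          (subst (λ r → ℚ.∣ r ∣ ℚ.< δ) (ℚ.+-identityʳ (seq x n))
            (q n (ℕ.m⊔n≤o⇒n≤o M N h)))))

x≈0⇒x*y≈0 : ∀ {x} y → x ≈ 0ℝ → x * y ≈ 0ℝ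
x≈0⇒x*y≈0 {x} y x≈0 = ≈-trans {x * y} {y * x} {0ℝ}
  (≈-pointwise {x * y} {y * x} λ n → ℚ.*-comm (seq x n) (seq y n)) (x≈0⇒y*x≈0 y {x} x≈0)

productℝ≈0 : ∀ {x xs} → x ∈ₗ xs → x ≈ 0ℝ → productℝ xs ≈ 0ℝ
productℝ≈0 {x} {_ ∷ xs} (here refl)  x≈0 = x≈0⇒x*y≈0 {x} (productℝ xs) x≈0
productℝ≈0 {x} {y ∷ xs} (there x∈xs) x≈0 = x≈0⇒y*x≈0 y {productℝ xs} (productℝ≈0 x∈xs x≈0)

-- `AllPairs` only compares an entry with later ones; symmetry covers the case where the first index
-- is the larger.
lookup-injective : ∀ {a ℓ} {A : Set a} {_∼_ : Rel A ℓ} → Symmetric _∼_ →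
  ∀ {xs} → AllPairs (λ x y → ¬ (x ∼ y)) xs →
  ∀ k l → lookup xs k ∼ lookup xs l → k ≡ l
lookup-injective ∼-sym (_   ∷ _)   zero    zero    _   = refl
lookup-injective ∼-sym (x∉  ∷ _)   zero    (suc l) x∼y = contradiction x∼y (All.lookup x∉ (∈-lookup l))
lookup-injective ∼-sym (x∉  ∷ _)   (suc k) zero    x∼y = contradiction (∼-sym x∼y) (All.lookup x∉ (∈-lookup k))
lookup-injective ∼-sym (_   ∷ xs!) (suc k) (suc l) x∼y = cong suc (lookup-injective ∼-sym xs! k l x∼y)

OpenCube⇒Cube : ∀ {m} {γ : Point m} → γ ∈ OpenCube → γ ∈ Cube
OpenCube⇒Cube {γ = γ} γ∈ j = <⇒≤ {0ℝ} {γ j} (proj₁ (γ∈ j)) , <⇒≤ {γ j} {1ℝ} (proj₂ (γ∈ j))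

OpenCube⇒∉L : ∀ {m} {γ : Point m} → γ ∈ OpenCube → ∀ i → ¬ (i ∈ L γ)
OpenCube⇒∉L {γ = γ} γ∈ i = [ >⇒≉ {γ i} {0ℝ} (proj₁ (γ∈ i)) , <⇒≉ {γ i} {1ℝ} (proj₂ (γ∈ i)) ]′

-- The two boundary clauses hold vacuously, as no coordinate equals 0 or 1.
interiorNash : ∀ {m} {G : TwoActionGame m} {γ : Point m} →
  γ ∈ OpenCube → (∀ i → Λ G i γ ≈ 0ℝ) → IsNash G γ
interiorNash {γ = γ} γ∈ Λ≈0 = record
  { inCube   = OpenCube⇒Cube {γ = γ} γ∈
  ; interior = λ i _ _ → Λ≈0 i
  ; atZero   = λ i γi≈0 → contradiction (inj₁ γi≈0) (OpenCube⇒∉L {γ = γ} γ∈ i)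
  ; atOne    = λ i γi≈1 → contradiction (inj₂ γi≈1) (OpenCube⇒∉L {γ = γ} γ∈ i)
  }

module _ {m} {G : TwoActionGame m} (P : IsProductGame G) where
  open IsProductGame P

  point : Permutation′ m → Point m
  point π j = a (π ⟨$⟩ʳ j) j

  point∈OpenCube : ∀ {π} → π ∈ Der m → point π ∈ OpenCube
  point∈OpenCube {π} der j = a-interior (π ⟨$⟩ʳ j) j (der j)

  -- The factor of player i's product indexed by j = π⁻¹(i) is a^i_j − a^i_j.
  Λ-point≈0 : ∀ {π} → π ∈ Der m → ∀ i → Λ G i (point π) ≈ 0ℝ
  Λ-point≈0 {π} der i =
    ≈-trans {Λ G i (point π)} {([-1]^ v i) * productℝ factors} {0ℝ}
      (Λ-product i (point π) (OpenCube⇒Cube {γ = point π} (point∈OpenCube {π} der)))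
      (x≈0⇒y*x≈0 ([-1]^ v i) {productℝ factors}
        (productℝ≈0 {factor j} (∈-map⁺ factor j∈others) factor-j≈0))
    where
    factor : Fin m → ℝ
    factor j = point π j - a i j

    factors : List ℝ
    factors = map factor (others i)

    j : Fin m
    j = π ⟨$⟩ˡ i

    πj≡i : π ⟨$⟩ʳ j ≡ i
    πj≡i = inverseʳ π

    j∈others : j ∈ₗ others i
    j∈others = ∈-filter⁺ (λ j → ¬? (j ≟ i)) (∈-allFin j)
      -- With `π j = i`, the equality `j = i` would make `j` a fixed point.
      λ j≡i → der j (trans πj≡i (sym j≡i))

    factor-j≈0 : factor j ≈ 0ℝ
    factor-j≈0 = ≈-pointwise {factor j} {0ℝ} λ n →
      -- The cancellation is exact at every index, since `a (π j) j` and `a i j` are the same real.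
      trans (cong (λ k → seq (a k j) n ℚ.- seq (a i j) n) πj≡i) (ℚ.+-inverseʳ (seq (a i j) n))

  point-isNash : ∀ {π} → π ∈ Der m → IsNash G (point π)
  point-isNash {π} der = interiorNash {γ = point π} (point∈OpenCube {π} der) (Λ-point≈0 {π} der)

  point∈EC : ∀ {π} → π ∈ Der m → point π ∈ EC P π
  point∈EC {π} der =
      OpenCube⇒Cube {γ = point π} (point∈OpenCube {π} der)
    -- Both `L (point π)` and `F π` are empty, so each inclusion is vacuous.
    , ( (λ {i} i∈L → contradiction i∈L (OpenCube⇒∉L {γ = point π} (point∈OpenCube {π} der) i))
      , (λ {i} i∈F → contradiction i∈F (der i)))
    , λ j _ → ≈-refl {point π j}

  -- `a-distinct` only refutes an equality of reals; decidable equality on `Fin m` turns this into a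
  -- proof that `π` and `ρ` agree at `j`.
  point-injective : ∀ {π ρ} → π ∈ Der m → ρ ∈ Der m → point π ≋ point ρ → π ≈ₚ ρ
  point-injective {π} {ρ} derπ derρ π≋ρ j = decidable-stable (π ⟨$⟩ʳ j ≟ ρ ⟨$⟩ʳ j) λ πj≢ρj →
    a-distinct (π ⟨$⟩ʳ j) (ρ ⟨$⟩ʳ j) j πj≢ρj (derπ j) (derρ j) (π≋ρ j)

derangements : ∀ m → List (Permutation′ m)
derangements m = filter Der? (permutations m)

derangement : ∀ m → Fin (! m) → Permutation′ m
derangement m = lookup (derangements m)

derangement∈Der : ∀ m k → derangement m k ∈ Der m
derangement∈Der m k = All.lookup (all-filter Der? (permutations m)) (∈-lookup k)

derangement-injective : ∀ m k l → derangement m k ≈ₚ derangement m l → k ≡ l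
derangement-injective m = lookup-injective {_∼_ = _≈ₚ_} (λ p i → sym (p i))
  (filter⁺ Der? (permutations-distinct m))

theorem3p7 : (m : ℕ) .{{_ : NonZero m}} (G : TwoActionGame m) (P : IsProductGame G) →
    ((π : Permutation′ m) → π ∈ Der m →
      let γ : Point m
          γ j = IsProductGame.a P (π ⟨$⟩ʳ j) j
      in γ ∈ EC P π
         × (∀ δ → δ ∈ EC P π → δ ≋ γ)
         × IsNash G γ
         × γ ∈ OpenCube)
    × (Σ[ f ∈ (Fin (! m) → Point m) ]
         (∀ k l → f k ≋ f l → k ≡ l)
         × (∀ k → IsNash G (f k) × f k ∈ OpenCube))
theorem3p7 m G P =
    (λ π der →
        point∈EC P {π} der
      -- No `j` is fixed by `π`, so the coordinate clause of `EC` applies at every `j`.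
      , (λ δ (_ , _ , δ≈a) j → δ≈a j (der j))
      , point-isNash P {π} der
      , point∈OpenCube P {π} der)
  , point P ∘ derangement m
  , (λ k l eq → derangement-injective m k l
      (point-injective P {derangement m k} {derangement m l}
        (derangement∈Der m k) (derangement∈Der m l) eq))
  , λ k → point-isNash P {derangement m k} (derangement∈Der m k)
        , point∈OpenCube P {derangement m k} (derangement∈Der m k)
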